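{- Let $G=(V,E)$ be a graph with $n$ vertices and $m$ edges and let $\sigma$ be a GEN-ordering of $G$. For each $i$, let $ln_i$ denote the position in $\sigma$ of the leftmost left neighbour of $\sigma(i)$ (i.e. $\min\{j<i : \sigma(j)\in N(\sigma(i))\}$), with $ln_i=-1$ if $\sigma(i)$ has no neighbour before it. Consider the procedure BFS-check: set $min\leftarrow n$; for $i=n$ down to $1$: if $ln_i>min$ return "NO"; if $ln_i\neq -1$ then $min\leftarrow ln_i$; after the loop return "YES". Then BFS-check returns "YES" if and only if $\sigma$ is a BFS-ordering of $G$, and given the values $ln_i$ it runs in $O(n)$ time. Moreover, whether an arbitrary ordering of $V$ is a BFS-ordering of $G$ can be decided in $O(n+m)$ time.
   Context: $G$ is a finite (not necessarily connected) undirected graph; $N(v)$ is the set of neighbours of $v$. An ordering of $V$ is a bijection $\sigma:\{1,\dots,n\}\to V$. $P_f(\mathbb{N}^+)$ is the set of finite subsets of positive integers; $umin(A)=\min A$ if $A\ne\emptyset$, $umin(\emptyset)=\infty$. $\mathrm{TBLS}(G,\prec,\tau)$ (for a strict partial order $\prec$ on $P_f(\mathbb{N}^+)$ and ordering $\tau$ of $V$) is the procedure: set $label(v)=\emptyset$ for every $v$; for $i=1,\dots,n$: let Eligible be the set of unnumbered vertices $x$ such that there is no unnumbered vertex $y$ with $label(x)\prec label(y)$; let $v$ be the first vertex of Eligible in $\tau$; set $\sigma(i)=v$ ($v$ becomes numbered); for every unnumbered neighbour $w$ of $v$ replace $label(w)$ by $label(w)\cup\{i\}$; output $\sigma$. A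 GEN-ordering is an output of $\mathrm{TBLS}(G,\prec_{gen},\tau)$ for some $\tau$, where $A\prec_{gen}B$ iff $A=\emptyset$ and $B\ne\emptyset$. A BFS-ordering is an output of $\mathrm{TBLS}(G,\prec_{BFS},\tau)$ for some $\tau$, where $A\prec_{BFS}B$ iff $umin(A)>umin(B)$. -}

module Defs where

open import Data.Bool.Base using (Bool; true; false; if_then_else_; not)
open import Data.Fin.Base as Fin using (Fin; toℕ)
import Data.Fin.Properties as Fin
open import Data.Fin.Permutation using (Permutation′; _⟨$⟩ʳ_; _⟨$⟩ˡ_)
open import Data.Integer.Base as ℤ using (ℤ; +_; +[1+_]; -1ℤ; 0ℤ)
import Data.Integer.Properties as ℤ
open import Data.List.Base
  using (List; []; _∷_; _∷ʳ_; length; map; concat; filter; find; tabulate; allFin; cartesianProduct)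
open import Data.List.Scans.Base using (scanl)
open import Data.List.Membership.Propositional using (_∈_; _∉_)
open import Data.List.Relation.Binary.BagAndSetEquality using (_∼[_]_; set; [_]-Equality)
open import Data.List.Relation.Unary.Any using (here; there)
open import Data.List.Relation.Unary.Unique.Propositional using (Unique)
open import Data.Maybe.Base using (maybe′)
open import Data.Nat.Base as ℕ using (ℕ; zero; suc; _+_; _≤_; _<_; _⊓_; NonZero)
import Data.Nat.Properties as ℕ
open import Data.Product.Base using (Σ; ∃; _×_; _,_; proj₁)
open import Data.Sum.Base using (inj₁; inj₂)
open import Function.Base using (_∘_)
open import Function.Bundles using (_⇔_; Equivalence)
open import Level using (0ℓ)
open import Relation.Binary.Bundles using (Setoid)
open import Relation.Binary.Core using (Rel)
open import Relation.Binary.Definitions using (Decidable; Symmetric; Irreflexive; DecidableEquality)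
open import Relation.Binary.Structures using (IsStrictPartialOrder)
open import Relation.Binary.PropositionalEquality.Core
  using (_≡_; _≢_; refl; sym; trans; cong; subst)
open import Relation.Nullary.Construct.Add.Supremum using (_⁺; ⊤⁺; [_])
open import Relation.Binary.Construct.Add.Supremum.Strict _<_ using (_<⁺_; <⁺-trans; <⁺-irrefl-≡)
open import Relation.Nullary.Decidable.Core using (does; ¬?; _×-dec_)
open import Relation.Nullary.Negation.Core using (¬_)

import Data.List.Membership.DecPropositional as DecMembership

record Graph (n : ℕ) : Set₁ where
  field
    Adj    : Rel (Fin n) 0ℓ
    adj?   : Decidable Adj
    symm   : Symmetric Adj
    irrefl : Irreflexive _≡_ Adj

open Graph public

edgeCount : ∀ {n} → Graph n → ℕ
edgeCount {n} G = length (filter (λ (u , v) → (u Fin.<? v) ×-dec adj? G u v)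
                                 (cartesianProduct (allFin n) (allFin n)))

-- σ ⟨$⟩ʳ i is the vertex at position i and σ ⟨$⟩ˡ v the position of v.
-- As Fin counts from 0, i : Fin n stands for the position suc (toℕ i).
Ordering : ℕ → Set
Ordering = Permutation′

-- A finite set of positive integers is a list, taken up to set equality.
ℕ⁺ : Set
ℕ⁺ = Σ ℕ NonZero

Label : Set
Label = List ℕ⁺

infix 4 _≈_ _≺gen_ _≺BFS_

_≈_ : Rel Label 0ℓ
A ≈ B = A ∼[ set ] B

umin : Label → ℕ ⁺
umin []      = ⊤⁺
umin (k ∷ A) with umin A
... | ⊤⁺    = [ proj₁ k ]
... | [ m ] = [ proj₁ k ⊓ m ]

_≺gen_ : Rel Label 0ℓ
A ≺gen B = A ≡ [] × B ≢ []

_≺BFS_ : Rel Label 0ℓ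
A ≺BFS B = umin B <⁺ umin A

private
  module ≈ = Setoid ([ set ]-Equality ℕ⁺)

  ≈[]⇒≡[] : ∀ {A} → A ≈ [] → A ≡ []
  ≈[]⇒≡[] {[]}    _ = refl
  ≈[]⇒≡[] {k ∷ A} e with Equivalence.to e (here refl)
  ... | ()

  umin-∈ : ∀ A {m} → umin A ≡ [ m ] → ∃ λ k → k ∈ A × proj₁ k ≡ m
  umin-∈ (k ∷ A) eq with umin A in eqA
  umin-∈ (k ∷ A) refl | ⊤⁺ = k , here refl , refl
  umin-∈ (k ∷ A) refl | [ m ] with ℕ.⊓-sel (proj₁ k) m
  ... | inj₁ p = k , here refl , sym p
  ... | inj₂ p with umin-∈ A eqA
  ...   | l , l∈A , q = l , there l∈A , trans q (sym p)

  umin-≤ : ∀ A {k} → k ∈ A → ∃ λ m → umin A ≡ [ m ] × m ≤ proj₁ k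
  umin-≤ (k ∷ A) (here refl) with umin A
  ... | ⊤⁺    = _ , refl , ℕ.≤-refl
  ... | [ m ] = _ , refl , ℕ.m⊓n≤m (proj₁ k) m
  umin-≤ (k ∷ A) (there l∈A) with umin A | umin-≤ A l∈A
  ... | .([ m ]) | m , refl , m≤l = _ , refl , ℕ.≤-trans (ℕ.m⊓n≤n (proj₁ k) m) m≤l

  umin-mono : ∀ {A B a} → A ≈ B → umin A ≡ [ a ] → ∃ λ b → umin B ≡ [ b ] × b ≤ a
  umin-mono {A} {B} e eq with umin-∈ A eq
  ... | k , k∈A , refl = umin-≤ B (Equivalence.to e k∈A)

  umin-cong : ∀ {A B} → A ≈ B → umin A ≡ umin B
  umin-cong {A} {B} e with umin A in eqA | umin B in eqB
  ... | ⊤⁺    | ⊤⁺    = refl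
  ... | [ a ] | ⊤⁺ with umin-mono {A} {B} e eqA
  ...   | b , eq , _ with trans (sym eqB) eq
  ...     | ()
  umin-cong {A} {B} e | ⊤⁺ | [ b ] with umin-mono {B} {A} (≈.sym {A} {B} e) eqB
  ...   | a , eq , _ with trans (sym eqA) eq
  ...     | ()
  umin-cong {A} {B} e | [ a ] | [ b ]
    with umin-mono {A} {B} e eqA | umin-mono {B} {A} (≈.sym {A} {B} e) eqB
  ... | b′ , p , b≤a | a′ , q , a≤b with trans (sym eqB) p | trans (sym eqA) q
  ...   | refl | refl = cong [_] (ℕ.≤-antisym a≤b b≤a)

≺gen-isStrictPartialOrder : IsStrictPartialOrder _≈_ _≺gen_
≺gen-isStrictPartialOrder = record
  { isEquivalence = ≈.isEquivalence
  ; irrefl        = λ { {A} {B} e (refl , B≢[]) → B≢[] (≈[]⇒≡[] (≈.sym {[]} {B} e)) }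
  ; trans         = λ { (A≡[] , B≢[]) (_ , C≢[]) → A≡[] , C≢[] }
  ; <-resp-≈      = (λ { {A} {B} {C} e (A≡[] , B≢[]) →
                         A≡[] , λ { refl → B≢[] (≈[]⇒≡[] e) } })
                  , (λ { {A} {B} {C} e (refl , A≢[]) →
                         ≈[]⇒≡[] (≈.sym {[]} {C} e) , A≢[] })
  }

≺BFS-isStrictPartialOrder : IsStrictPartialOrder _≈_ _≺BFS_
≺BFS-isStrictPartialOrder = record
  { isEquivalence = ≈.isEquivalence
  ; irrefl        = λ {A} {B} e → <⁺-irrefl-≡ ℕ.<-irrefl (sym (umin-cong {A} {B} e))
  ; trans         = λ p q → <⁺-trans ℕ.<-trans q p
  ; <-resp-≈      = (λ {A} {B} {C} e → subst (_<⁺ umin A) (umin-cong {B} {C} e))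
                  , (λ {A} {B} {C} e → subst (umin A <⁺_) (umin-cong {B} {C} e))
  }

module TBLS {_≺_ : Rel Label 0ℓ} (≺-isStrictPartialOrder : IsStrictPartialOrder _≈_ _≺_)
            {n : ℕ} (G : Graph n) (τ : Ordering n) where

  open DecMembership (Fin._≟_ {n}) using (_∈?_)

  -- In what follows s lists the vertices numbered so far, in the order
  -- in which they were numbered.

  Eligible : List (Fin n) → (Fin n → Label) → Fin n → Set
  Eligible s label x = x ∉ s × ¬ (∃ λ y → y ∉ s × label x ≺ label y)

  FirstEligible : List (Fin n) → (Fin n → Label) → Fin n → Set
  FirstEligible s label v =
    Eligible s label v × (∀ u → Eligible s label u → τ ⟨$⟩ˡ v Fin.≤ τ ⟨$⟩ˡ u)

  -- v is numbered suc (length s).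
  relabel : List (Fin n) → (Fin n → Label) → Fin n → (Fin n → Label)
  relabel s label v w =
    if does (adj? G v w ×-dec ¬? (w ∈? (s ∷ʳ v)))
    then (suc (length s) , _) ∷ label w
    else label w

  data Reachable : List (Fin n) → (Fin n → Label) → Set where
    start : Reachable [] (λ _ → [])
    next  : ∀ {s label v} → Reachable s label → FirstEligible s label v →
            Reachable (s ∷ʳ v) (relabel s label v)

  Output : Ordering n → Set
  Output σ = ∃ λ label → Reachable (tabulate (σ ⟨$⟩ʳ_)) label

IsGENOrdering : ∀ {n} → Graph n → Ordering n → Set
IsGENOrdering G σ = ∃ λ τ → TBLS.Output ≺gen-isStrictPartialOrder G τ σ

IsBFSOrdering : ∀ {n} → Graph n → Ordering n → Set
IsBFSOrdering G σ = ∃ λ τ → TBLS.Output ≺BFS-isStrictPartialOrder G τ σ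

-- Since allFin n is increasing, find returns the least suitable position.
leftmostLeft : ∀ {n} → Graph n → Ordering n → Fin n → ℤ
leftmostLeft {n} G σ i =
  maybe′ (λ j → +[1+ toℕ j ]) -1ℤ
    (find (λ j → (j Fin.<? i) ×-dec adj? G (σ ⟨$⟩ʳ i) (σ ⟨$⟩ʳ j)) (allFin n))

-- A random access machine, programmed by while programs over integer
-- registers and integer arrays.  The only arithmetic is ± 1, so after t
-- operations every stored number exceeds those in the program and its input by
-- at most t: unit cost does not hide computation on long numbers.

Reg Arr : Set
Reg = ℕ
Arr = ℕ

infix  8 _at_
infix  6 _>ᵉ_ _≢ᵉ_
infix  5 _≔_ _⟨_⟩≔_
infix  4 If_Then_Else_ While_Do_
infixr 3 _⨾_
infix  2 ⟨_,_⟩⇓_cost_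

data Expr : Set where
  lit     : ℤ → Expr
  reg     : Reg → Expr
  _at_    : Arr → Expr → Expr
  inc dec : Expr → Expr

data Test : Set where
  _>ᵉ_ _≢ᵉ_ : Expr → Expr → Test

data Answer : Set where
  YES NO : Answer

data Stmt : Set where
  skip          : Stmt
  _≔_           : Reg → Expr → Stmt
  _⟨_⟩≔_        : Arr → Expr → Expr → Stmt
  _⨾_           : Stmt → Stmt → Stmt
  If_Then_Else_ : Test → Stmt → Stmt → Stmt
  While_Do_     : Test → Stmt → Stmt
  return        : Answer → Stmt

record State : Set where
  constructor state
  field
    regs : Reg → ℤ
    arrs : Arr → ℤ → ℤ

open State public

update : ∀ {A B : Set} → DecidableEquality A → (A → B) → A → B → (A → B)
update _≟_ f a b x = if does (x ≟ a) then b else f x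

setReg : Reg → ℤ → State → State
setReg r z (state ρ α) = state (update ℕ._≟_ ρ r z) α

setArr : Arr → ℤ → ℤ → State → State
setArr a k z (state ρ α) = state ρ (update ℕ._≟_ α a (update ℤ._≟_ (α a) k z))

⟦_⟧ᵉ : Expr → State → ℤ
⟦ lit z  ⟧ᵉ S = z
⟦ reg r  ⟧ᵉ S = regs S r
⟦ a at e ⟧ᵉ S = arrs S a (⟦ e ⟧ᵉ S)
⟦ inc e  ⟧ᵉ S = ℤ.suc (⟦ e ⟧ᵉ S)
⟦ dec e  ⟧ᵉ S = ℤ.pred (⟦ e ⟧ᵉ S)

⟦_⟧ᵗ : Test → State → Bool
⟦ e >ᵉ f ⟧ᵗ S = does (⟦ f ⟧ᵉ S ℤ.<? ⟦ e ⟧ᵉ S)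
⟦ e ≢ᵉ f ⟧ᵗ S = not (does (⟦ e ⟧ᵉ S ℤ.≟ ⟦ f ⟧ᵉ S))

costᵉ : Expr → ℕ
costᵉ (lit z)  = 1
costᵉ (reg r)  = 1
costᵉ (a at e) = suc (costᵉ e)
costᵉ (inc e)  = suc (costᵉ e)
costᵉ (dec e)  = suc (costᵉ e)

costᵗ : Test → ℕ
costᵗ (e >ᵉ f) = suc (costᵉ e + costᵉ f)
costᵗ (e ≢ᵉ f) = suc (costᵉ e + costᵉ f)

data Outcome : Set where
  running  : State → Outcome
  returned : Answer → Outcome

-- ⟨ p , S ⟩⇓ o cost t: started in S, the program p halts with outcome o
-- after t elementary operations.
data ⟨_,_⟩⇓_cost_ : Stmt → State → Outcome → ℕ → Set where
  ⇓skip : ∀ {S} → ⟨ skip , S ⟩⇓ running S cost 1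

  ⇓reg : ∀ {r e S} →
    ⟨ r ≔ e , S ⟩⇓ running (setReg r (⟦ e ⟧ᵉ S) S) cost suc (costᵉ e)

  ⇓arr : ∀ {a e f S} →
    ⟨ a ⟨ e ⟩≔ f , S ⟩⇓ running (setArr a (⟦ e ⟧ᵉ S) (⟦ f ⟧ᵉ S) S)
      cost suc (costᵉ e + costᵉ f)

  ⇓seq : ∀ {p q S S′ o t u} →
    ⟨ p , S ⟩⇓ running S′ cost t → ⟨ q , S′ ⟩⇓ o cost u →
    ⟨ p ⨾ q , S ⟩⇓ o cost t + u

  ⇓seq-returned : ∀ {p q S x t} →
    ⟨ p , S ⟩⇓ returned x cost t →
    ⟨ p ⨾ q , S ⟩⇓ returned x cost t

  ⇓if-true : ∀ {b p q S o t} →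
    ⟦ b ⟧ᵗ S ≡ true → ⟨ p , S ⟩⇓ o cost t →
    ⟨ If b Then p Else q , S ⟩⇓ o cost costᵗ b + t

  ⇓if-false : ∀ {b p q S o t} →
    ⟦ b ⟧ᵗ S ≡ false → ⟨ q , S ⟩⇓ o cost t →
    ⟨ If b Then p Else q , S ⟩⇓ o cost costᵗ b + t

  ⇓while-false : ∀ {b p S} →
    ⟦ b ⟧ᵗ S ≡ false →
    ⟨ While b Do p , S ⟩⇓ running S cost costᵗ b

  ⇓while-true : ∀ {b p S S′ o t u} →
    ⟦ b ⟧ᵗ S ≡ true →
    ⟨ p , S ⟩⇓ running S′ cost t → ⟨ While b Do p , S′ ⟩⇓ o cost u →
    ⟨ While b Do p , S ⟩⇓ o cost costᵗ b + (t + u)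

  ⇓while-returned : ∀ {b p S x t} →
    ⟦ b ⟧ᵗ S ≡ true →
    ⟨ p , S ⟩⇓ returned x cost t →
    ⟨ While b Do p , S ⟩⇓ returned x cost costᵗ b + t

  ⇓return : ∀ {x S} → ⟨ return x , S ⟩⇓ returned x cost 1

-- Inputs.  Arrays are indexed from 1 and the vertices are numbered from 1;
-- registers and array cells not used by the input contain 0.

arrayOf : List ℤ → ℤ → ℤ
arrayOf (x ∷ xs) +[1+ zero ]  = x
arrayOf (x ∷ xs) +[1+ suc k ] = arrayOf xs +[1+ k ]
arrayOf _        _            = 0ℤ

vertexNumber : ∀ {n} → Fin n → ℤ
vertexNumber v = +[1+ toℕ v ]

sizeᴿ minᴿ iᴿ : Reg
sizeᴿ = 0
minᴿ  = 1
iᴿ    = 2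

lnᴬ orderᴬ offsetᴬ targetᴬ : Arr
lnᴬ     = 0
orderᴬ  = 1
offsetᴬ = 2
targetᴬ = 3

initialRegs : ℕ → Reg → ℤ
initialRegs n 0       = + n
initialRegs n (suc _) = 0ℤ

leftmostLeftInput : ∀ {n} → Graph n → Ordering n → State
leftmostLeftInput {n} G σ = state (initialRegs n) arrays
  where
  arrays : Arr → ℤ → ℤ
  arrays 0 = arrayOf (tabulate (leftmostLeft G σ))
  arrays _ = arrayOf []

record AdjacencyLists {n : ℕ} (G : Graph n) : Set where
  field
    nbrs     : Fin n → List (Fin n)
    unique   : ∀ u → Unique (nbrs u)
    complete : ∀ u v → v ∈ nbrs u ⇔ Adj G u v

-- The adjacency lists are stored one after the other in targetᴬ; the list
-- of the vertex numbered k occupies the cells from offsetᴬ at k (included)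
-- to offsetᴬ at k + 1 (excluded).
graphInput : ∀ {n} {G : Graph n} → AdjacencyLists G → Ordering n → State
graphInput {n} L σ = state (initialRegs n) arrays
  where
  lists : List (List (Fin n))
  lists = tabulate (AdjacencyLists.nbrs L)

  arrays : Arr → ℤ → ℤ
  arrays 1 = arrayOf (tabulate (λ i → vertexNumber (σ ⟨$⟩ʳ i)))
  arrays 2 = arrayOf (map +_ (scanl (λ k vs → k + length vs) 1 lists))
  arrays 3 = arrayOf (map vertexNumber (concat lists))
  arrays _ = arrayOf []

bfsCheck : Stmt
bfsCheck =
  minᴿ ≔ reg sizeᴿ ⨾
  iᴿ ≔ reg sizeᴿ ⨾
  While reg iᴿ >ᵉ lit 0ℤ Do (
    If lnᴬ at reg iᴿ >ᵉ reg minᴿ Then return NO Else skip ⨾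
    If lnᴬ at reg iᴿ ≢ᵉ lit -1ℤ Then minᴿ ≔ lnᴬ at reg iᴿ Else skip ⨾
    iᴿ ≔ dec (reg iᴿ)) ⨾
  return YES

{-# OPTIONS --safe #-}
module Submission where

-- σ is a BFS-ordering iff the root of σ(i), the position of the leftmost vertex
-- of the closed neighbourhood of σ(i), is nondecreasing in i: at time i the
-- labels of the unnumbered vertices are the sets of positions of their earlier
-- neighbours, and the tie-break τ = σ realises any σ whose vertices are
-- eligible in turn.  If σ is a GEN-ordering, a vertex without left neighbours
-- cannot violate this monotonicity, so that only the values lnᵢ ≠ -1 matter;
-- and BFS-check compares consecutive ones.  For an arbitrary σ the roots are found
-- by letting each vertex in turn mark its unmarked neighbours, which takes
-- one pass over the adjacency lists.

open import Data.Bool.Base using (Bool; true; false; not)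
open import Data.Fin.Base as Fin using (Fin; toℕ; fromℕ<)
import Data.Fin.Properties as Fin
open import Data.Fin.Permutation using (_⟨$⟩ʳ_; _⟨$⟩ˡ_; inverseˡ; inverseʳ)
open import Data.Integer.Base as ℤ using (ℤ; +_; +[1+_]; -1ℤ; 0ℤ)
import Data.Integer.Properties as ℤ
open import Data.List.Base
  using (List; []; _∷_; _∷ʳ_; _++_; map; concat; filter; find; length; tabulate;
         take; drop; allFin; cartesianProduct)
import Data.List.Properties as List
import Data.List.Membership.DecPropositional as DecMembership
open import Data.List.Membership.Propositional using (_∈_; _∉_)
open import Data.List.Membership.Propositional.Properties
  using (∈-++⁺ˡ; ∈-++⁺ʳ; ∈-++⁻; ∈-∃++; ∈-allFin; ∈-tabulate⁻; ∈-map⁺; ∈-map⁻;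
         ∈-concat⁻′; ∈-filter⁺; ∈-cartesianProduct⁺)
open import Data.List.Relation.Binary.Subset.Propositional using (_⊆_)
open import Data.List.Relation.Unary.All as All using (All; []; _∷_)
import Data.List.Relation.Unary.All.Properties as All
open import Data.List.Relation.Unary.AllPairs using (AllPairs; []; _∷_)
import Data.List.Relation.Unary.AllPairs.Properties as AllPairs
open import Data.List.Relation.Unary.Any using (here; there)
open import Data.List.Relation.Unary.Unique.Propositional using (Unique)
import Data.List.Relation.Unary.Unique.Propositional.Properties as Unique
open import Data.List.Scans.Base using (scanl)
open import Data.Maybe.Base using (Maybe; just; nothing; maybe′; fromMaybe)
open import Data.Nat.Base as ℕ using (ℕ; zero; suc; _+_; _*_; _≤_; _<_; z≤n; s≤s)
import Data.Nat.Properties as ℕ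
open import Data.Nat.Solver using (module +-*-Solver)
open import Data.Product.Base using (∃; ∃₂; _×_; _,_; proj₁; proj₂; map₂; swap)
open import Data.Sum.Base as Sum using (_⊎_; inj₁; inj₂)
open import Function.Base using (_∘_; id)
open import Function.Bundles using (_⇔_; mk⇔; Equivalence)
open import Level using (0ℓ)
open import Relation.Binary.Construct.Add.Supremum.Strict _<_ using (_<⁺_; [_]; [_]<⊤⁺)
open import Relation.Binary.Core using (Rel)
open import Relation.Binary.Definitions using (DecidableEquality; tri<; tri≈; tri>)
open import Relation.Binary.PropositionalEquality
  using (_≡_; _≢_; refl; sym; trans; cong; cong₂; subst; subst₂; module ≡-Reasoning)
open import Relation.Binary.Structures using (IsStrictPartialOrder)
open import Relation.Nullary.Construct.Add.Supremum using (⊤⁺; [_])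
open import Relation.Nullary.Decidable using (yes; no; does; _×-dec_; dec-true; dec-false)
open import Relation.Nullary.Negation using (¬_; contradiction)
open import Relation.Unary using (Decidable)
open import Defs

-- The order on labels

<⁺umin : ∀ {m} A → [ m ] <⁺ umin A ⇔ All ((m <_) ∘ proj₁) A
<⁺umin []      = mk⇔ (λ _ → []) (λ _ → [ _ ]<⊤⁺)
<⁺umin (k ∷ A) with umin A | <⁺umin A
... | ⊤⁺    | A⇔ = mk⇔
  (λ { [ m<k ] → m<k ∷ Equivalence.to A⇔ [ _ ]<⊤⁺ })
  (λ { (m<k ∷ _) → [ m<k ] })
... | [ l ] | A⇔ = mk⇔
  (λ { [ m<k⊓l ] → ℕ.<-≤-trans m<k⊓l (ℕ.m⊓n≤m _ l)
                 ∷ Equivalence.to A⇔ [ ℕ.<-≤-trans m<k⊓l (ℕ.m⊓n≤n (proj₁ k) l) ] })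
  (λ { (m<k ∷ m<A) → [ minimal m<k (Equivalence.from A⇔ m<A) ] })
  where
  minimal : ∀ {m k l} → m < k → [ m ] <⁺ [ l ] → m < k ℕ.⊓ l
  minimal m<k [ m<l ] = ℕ.⊓-glb m<k m<l

umin-attained : ∀ A {x} → umin A <⁺ x → ∃ λ k → k ∈ A × [ proj₁ k ] <⁺ x
umin-attained (k ∷ A) <x with umin A | umin-attained A
... | ⊤⁺    | _  = k , here refl , <x
... | [ l ] | ih with ℕ.⊓-sel (proj₁ k) l
...   | inj₁ eq = k , here refl , subst (λ m → [ m ] <⁺ _) eq <x
...   | inj₂ eq = let k′ , k′∈A , k′<x = ih (subst (λ m → [ m ] <⁺ _) eq <x)
                  in k′ , there k′∈A , k′<x

umin-≤ : ∀ A {k x} → k ∈ A → [ proj₁ k ] <⁺ x → umin A <⁺ x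
umin-≤ (k ∷ A) (here refl) k<x with umin A
... | ⊤⁺    = k<x
... | [ l ] = down k<x
  where
  down : ∀ {x} → [ proj₁ k ] <⁺ x → [ proj₁ k ℕ.⊓ l ] <⁺ x
  down [ k<m ]    = [ ℕ.≤-<-trans (ℕ.m⊓n≤m _ l) k<m ]
  down [ _ ]<⊤⁺ = [ _ ]<⊤⁺
umin-≤ (k ∷ A) (there k′∈A) k′<x with umin A | umin-≤ A k′∈A k′<x
... | [ l ] | [ l<m ]    = [ ℕ.≤-<-trans (ℕ.m⊓n≤n (proj₁ k) l) l<m ]
... | [ l ] | [ _ ]<⊤⁺ = [ _ ]<⊤⁺

-- Removes `umin`: later arguments compare labels only through their members, so neither the order
-- nor the repetitions in a list matter.
≺BFS⇔ : ∀ A B → A ≺BFS B ⇔ (∃ λ k → k ∈ B × All ((proj₁ k <_) ∘ proj₁) A)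
≺BFS⇔ A B = mk⇔
  (λ A≺B → map₂ (map₂ (Equivalence.to (<⁺umin A))) (umin-attained B A≺B))
  (λ (k , k∈B , k<A) → umin-≤ B k∈B (Equivalence.from (<⁺umin A) k<A))

-- Prefixes of an ordering

module _ {A : Set} {n} (f : Fin n → A) where

  take-full : take n (tabulate f) ≡ tabulate f
  take-full = List.take-all n _ (ℕ.≤-reflexive (List.length-tabulate f))

  length-take-tabulate : ∀ {p} → p ≤ n → length (take p (tabulate f)) ≡ p
  length-take-tabulate {p} p≤n = trans (List.length-take p (tabulate f))
    (ℕ.m≤n⇒m⊓n≡m (subst (p ≤_) (sym (List.length-tabulate f)) p≤n))

∈-take-tabulate⁻ : ∀ {A : Set} {n} (f : Fin n → A) p {x} → x ∈ take p (tabulate f) →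
                   ∃ λ j → toℕ j < p × x ≡ f j
∈-take-tabulate⁻ {n = suc n} f (suc p) (here refl) = Fin.zero , s≤s z≤n , refl
∈-take-tabulate⁻ {n = suc n} f (suc p) (there x∈)
  with j , j<p , eq ← ∈-take-tabulate⁻ (f ∘ Fin.suc) p x∈ = Fin.suc j , s≤s j<p , eq

∈-take-tabulate⁺ : ∀ {A : Set} {n} (f : Fin n → A) {p j} → toℕ j < p → f j ∈ take p (tabulate f)
∈-take-tabulate⁺ f {suc p} {Fin.zero}  _         = here refl
∈-take-tabulate⁺ f {suc p} {Fin.suc j} (s≤s j<p) = there (∈-take-tabulate⁺ (f ∘ Fin.suc) j<p)

position : ∀ {n p} → p < n → ∃ λ (i : Fin n) → toℕ i ≡ p
position p<n = fromℕ< p<n , Fin.toℕ-fromℕ< p<n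

module _ {n} (σ : Ordering n) where

  vertexAt : Fin n → Fin n
  vertexAt = σ ⟨$⟩ʳ_

  vertexAt-injective : ∀ {i j} → vertexAt i ≡ vertexAt j → i ≡ j
  vertexAt-injective {i} {j} eq = trans (sym (inverseˡ σ)) (trans (cong (σ ⟨$⟩ˡ_) eq) (inverseˡ σ))

  prefix : ℕ → List (Fin n)
  prefix p = take p (tabulate vertexAt)

  ∉-prefix⁺ : ∀ {p j} → p ≤ toℕ j → vertexAt j ∉ prefix p
  ∉-prefix⁺ {p} p≤j j∈ with k , k<p , eq ← ∈-take-tabulate⁻ vertexAt p j∈
    rewrite vertexAt-injective eq = ℕ.<⇒≱ k<p p≤j

  ∉-prefix⁻ : ∀ {p w} → w ∉ prefix p → ∃ λ j → w ≡ vertexAt j × p ≤ toℕ j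
  ∉-prefix⁻ {p} {w} w∉ = σ ⟨$⟩ˡ w , sym (inverseʳ σ) , ℕ.≮⇒≥ λ j<p →
    w∉ (subst (_∈ prefix p) (inverseʳ σ) (∈-take-tabulate⁺ vertexAt j<p))

-- Runs of TBLS

module _ {n} (G : Graph n) (σ : Ordering n) where

  EarlierNbr : ℕ → Fin n → Fin n → Set
  EarlierNbr p w j = toℕ j < p × Adj G w (vertexAt σ j)

  earlierNbr? : ∀ p w → Decidable (EarlierNbr p w)
  earlierNbr? p w j = (toℕ j ℕ.<? p) ×-dec adj? G w (vertexAt σ j)

  -- A list represents its label only as a set, hence two inclusions in place of an equation. The
  -- `suc` is there because labels count positions from 1.
  record LabelAt (p : ℕ) (w : Fin n) (A : Label) : Set where
    field
      sound    : ∀ {k} → k ∈ A → ∃ λ j → EarlierNbr p w j × proj₁ k ≡ suc (toℕ j)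
      complete : ∀ {j} → EarlierNbr p w j → ∃ λ k → k ∈ A × proj₁ k ≡ suc (toℕ j)

  open LabelAt

  module _ {_≺_ : Rel Label 0ℓ} (≺-isSPO : IsStrictPartialOrder _≈_ _≺_) (τ : Ordering n) where

    open TBLS ≺-isSPO G τ
    open DecMembership (Fin._≟_ {n}) using (_∈?_)

    -- Only unnumbered vertices are described: a label stops growing when its vertex is numbered and
    -- may miss neighbours numbered later.
    LabelledUpTo : ℕ → (Fin n → Label) → Set
    LabelledUpTo p label = ∀ {j} → p ≤ toℕ j → LabelAt p (vertexAt σ j) (label (vertexAt σ j))

    labelledUpTo-next : ∀ label i → LabelledUpTo (toℕ i) label →
      LabelledUpTo (suc (toℕ i)) (relabel (prefix σ (toℕ i)) label (vertexAt σ i))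
    labelledUpTo-next label i inv {j} i<j
      with adj? G (vertexAt σ i) (vertexAt σ j)
    ... | no  ¬adj = record
      { sound    = λ k∈ → let l , (l<i , a) , eq = sound old k∈ in l , (ℕ.m<n⇒m<1+n l<i , a) , eq
      ; complete = λ (l<1+i , a) → complete old (ℕ.≤∧≢⇒< (ℕ.s≤s⁻¹ l<1+i)
                     (λ l≡i → ¬adj (subst (λ k → Adj G (vertexAt σ k) _) (Fin.toℕ-injective l≡i) (symm G a))) , a)
      }
      where old = inv (ℕ.<⇒≤ i<j)
    ... | yes adj
      -- `j` lies after `i`, so its vertex is still unnumbered and the second test of `relabel`
      -- succeeds.
      rewrite dec-false (vertexAt σ j ∈? (prefix σ (toℕ i) ∷ʳ vertexAt σ i))
                (subst (vertexAt σ j ∉_) (List.take-suc-tabulate (vertexAt σ) i) (∉-prefix⁺ σ i<j))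
      = record
      { sound    = λ { (here refl) → i , (ℕ.n<1+n _ , symm G adj) ,
                                        cong suc (length-take-tabulate (vertexAt σ) (ℕ.<⇒≤ (Fin.toℕ<n i)))
                     ; (there k∈) → let l , (l<i , a) , eq = sound old k∈ in l , (ℕ.m<n⇒m<1+n l<i , a) , eq }
      ; complete = λ {l} (l<1+i , a) → case-l l (ℕ.m≤n⇒m<n∨m≡n (ℕ.s≤s⁻¹ l<1+i)) a
      }
      where
      old = inv (ℕ.<⇒≤ i<j)
      case-l : ∀ l → toℕ l < toℕ i ⊎ toℕ l ≡ toℕ i → Adj G (vertexAt σ j) (vertexAt σ l) →
        ∃ λ k → k ∈ ((suc (length (prefix σ (toℕ i))) , _) ∷ label (vertexAt σ j)) × proj₁ k ≡ suc (toℕ l)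
      case-l l (inj₁ l<i) a = let k , k∈ , eq = complete old (l<i , a) in k , there k∈ , eq
      case-l l (inj₂ l≡i) a = _ , here refl ,
        cong suc (trans (length-take-tabulate (vertexAt σ) (ℕ.<⇒≤ (Fin.toℕ<n i))) (sym l≡i))

    EligibleAt : Fin n → (Fin n → Label) → Set
    EligibleAt i label = Eligible (prefix σ (toℕ i)) label (vertexAt σ i)

    -- Each step appends one vertex, so a run that has numbered the first `p` vertices of `σ` has
    -- passed through every shorter prefix. The induction keeps, for each `i`, the labels at the
    -- moment when the vertex at `i` was chosen.
    reachable-prefix⁻ : ∀ {s label p} → Reachable s label → p ≤ n → s ≡ prefix σ p →
      LabelledUpTo p label ×
      (∀ {i} → toℕ i < p → ∃ λ label → LabelledUpTo (toℕ i) label × EligibleAt i label)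
    reachable-prefix⁻ {p = zero} start _ _ =
      (λ _ → record { sound = λ (); complete = λ () }) , λ ()
    reachable-prefix⁻ {p = suc p} start (s≤s _) ()
    reachable-prefix⁻ {p = zero} (next {s = []} _ _) _ ()
    reachable-prefix⁻ {p = zero} (next {s = _ ∷ _} _ _) _ ()
    reachable-prefix⁻ {p = suc p} (next {s} {label} run (eligible , _)) p<n eq
      with j , refl ← position p<n
      with refl , refl ← List.∷ʳ-injective s _ (trans eq (List.take-suc-tabulate (vertexAt σ) j))
      with labelled , earlier ← reachable-prefix⁻ run (ℕ.<⇒≤ p<n) refl
      = labelledUpTo-next label j labelled , λ i<1+j → case (ℕ.m≤n⇒m<n∨m≡n (ℕ.s≤s⁻¹ i<1+j))
      where
      case : ∀ {i} → toℕ i < toℕ j ⊎ toℕ i ≡ toℕ j → ∃ λ label → LabelledUpTo (toℕ i) label × EligibleAt i label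
      case (inj₁ i<j) = earlier i<j
      case (inj₂ i≡j) with refl ← Fin.toℕ-injective i≡j = label , labelled , eligible

    output⇒eligible : Output σ → ∀ i → ∃ λ label → LabelledUpTo (toℕ i) label × EligibleAt i label
    output⇒eligible (label , run) i =
      proj₂ (reachable-prefix⁻ run ℕ.≤-refl (sym (take-full (vertexAt σ)))) (Fin.toℕ<n i)

  module _ {_≺_ : Rel Label 0ℓ} (≺-isSPO : IsStrictPartialOrder _≈_ _≺_)
           (eligible : ∀ i label → LabelledUpTo ≺-isSPO σ (toℕ i) label → EligibleAt ≺-isSPO σ i label) where

    open TBLS ≺-isSPO G σ

    reachable-prefix⁺ : ∀ p → p ≤ n → ∃ λ label → Reachable (prefix σ p) label × LabelledUpTo ≺-isSPO σ p label
    reachable-prefix⁺ zero    _   = _ , start , λ _ → record { sound = λ (); complete = λ () }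
    reachable-prefix⁺ (suc p) p<n
      with label , run , labelled ← reachable-prefix⁺ p (ℕ.<⇒≤ p<n)
      with j , refl ← position p<n
      = relabel (prefix σ p) label (vertexAt σ j)
      , subst (λ s → Reachable s (relabel (prefix σ p) label (vertexAt σ j)))
          (sym (List.take-suc-tabulate (vertexAt σ) j))
          (next run (eligible j label labelled , first))
      , labelledUpTo-next ≺-isSPO σ label j labelled
      where
      -- An eligible vertex is unnumbered, hence not before `j` in `σ`; with `σ` as the tie-break,
      -- the vertex at `j` comes first.
      first : ∀ u → Eligible (prefix σ p) label u → σ ⟨$⟩ˡ vertexAt σ j Fin.≤ σ ⟨$⟩ˡ u
      first u (u∉ , _) with k , refl , j≤k ← ∉-prefix⁻ σ u∉ =
        subst₂ Fin._≤_ (sym (inverseˡ σ)) (sym (inverseˡ σ)) j≤k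

    eligible⇒output : Output σ
    eligible⇒output = let label , run , _ = reachable-prefix⁺ n ℕ.≤-refl in
      label , subst (λ s → Reachable s label) (take-full (vertexAt σ)) run

  -- Eligibility of the vertex at `i` with the labels eliminated: the neighbour `k` must not let the
  -- unnumbered vertex at `j` beat it. The case `i = j` is harmless, as `l = k` serves.
  GENCondition BFSCondition : Set
  GENCondition = ∀ {i j k} → i Fin.≤ j → k Fin.< i → Adj G (vertexAt σ j) (vertexAt σ k) →
    ∃ λ l → l Fin.< i × Adj G (vertexAt σ i) (vertexAt σ l)
  BFSCondition = ∀ {i j k} → i Fin.≤ j → k Fin.< i → Adj G (vertexAt σ j) (vertexAt σ k) →
    ∃ λ l → l Fin.≤ k × Adj G (vertexAt σ i) (vertexAt σ l)

  -- Were the label of the vertex at `i` empty, the unnumbered vertex at `j`, whose label records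
  -- `k`, would make it ineligible. Any member of the nonempty label names an earlier neighbour.
  GEN⇒condition : IsGENOrdering G σ → GENCondition
  GEN⇒condition (τ , out) {i} {j} i≤j k<i adj
    with label , labelled , (_ , eligible) ← output⇒eligible ≺gen-isStrictPartialOrder τ out i
    with label (vertexAt σ i) | labelled {i} ℕ.≤-refl
  ... | [] | _ = contradiction
        (vertexAt σ j , ∉-prefix⁺ σ i≤j , refl , λ eq′ →
          ∉[] (subst (_ ∈_) eq′ (proj₁ (proj₂ (complete (labelled i≤j) (k<i , adj))))))
        eligible
    where
    ∉[] : ∀ {k : ℕ⁺} → k ∉ []
    ∉[] ()
  ... | _ ∷ _ | L = map₂ proj₁ (sound L (here refl))

  -- Label members are positions of earlier neighbours, so the vertex at `j` beats the one at `i`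
  -- exactly when some neighbour of the former before `i` precedes all those of the latter.
  BFS⇔condition : IsBFSOrdering G σ ⇔ BFSCondition
  BFS⇔condition = mk⇔ to from
    where
    to : IsBFSOrdering G σ → BFSCondition
    to (τ , out) {i} {j} {k} i≤j k<i adj
      with label , labelled , (_ , eligible) ← output⇒eligible ≺BFS-isStrictPartialOrder τ out i
      -- The wanted `l` is searched for; if there is none, the member standing for `k` lies below
      -- the whole label of `i`, against eligibility.
      with Fin.any? (λ l → (l Fin.≤? k) ×-dec adj? G (vertexAt σ i) (vertexAt σ l))
    ... | yes found = found
    ... | no  none  = contradiction (vertexAt σ j , ∉-prefix⁺ σ i≤j , Equivalence.from (≺BFS⇔ _ _)
          (let m , m∈ , m≡ = complete (labelled i≤j) (k<i , adj)
           in m , m∈ , All.tabulate λ m′∈ →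
             let l , (_ , a) , m′≡ = sound (labelled ℕ.≤-refl) m′∈ in
             subst₂ _<_ (sym m≡) (sym m′≡) (s≤s (ℕ.≰⇒> λ l≤k → none (l , l≤k , a))))) eligible
    from : BFSCondition → IsBFSOrdering G σ
    from cond = σ , eligible⇒output ≺BFS-isStrictPartialOrder λ i label labelled → ∉-prefix⁺ σ ℕ.≤-refl ,
      λ (y , y∉ , i≺y) → case i label labelled (∉-prefix⁻ σ y∉) i≺y
      where
      case : ∀ i label {y} → LabelledUpTo ≺BFS-isStrictPartialOrder σ (toℕ i) label →
        (∃ λ j → y ≡ vertexAt σ j × toℕ i ≤ toℕ j) → ¬ (label (vertexAt σ i) ≺BFS label y)
      case i label labelled (j , refl , i≤j) i≺j =
        let m , m∈ , m<    = Equivalence.to (≺BFS⇔ _ _) i≺j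
            k , (k<i , a) , m≡ = sound (labelled i≤j) m∈
            l , l≤k , a′       = cond i≤j k<i a
            m′ , m′∈ , m′≡     = complete (labelled ℕ.≤-refl) (ℕ.≤-<-trans l≤k k<i , a′)
        in ℕ.<⇒≱ (subst₂ _<_ m≡ m′≡ (All.lookup m< m′∈)) (s≤s l≤k)

-- Left neighbours and roots

-- Specifies a search result independently of how it was found: it describes both `find` and the
-- cells that the linear-time check fills.
data Leftmost {n} (P : Fin n → Set) : Maybe (Fin n) → Set where
  none : (∀ {j} → ¬ P j) → Leftmost P nothing
  some : ∀ {j} → P j → (∀ {k} → P k → j Fin.≤ k) → Leftmost P (just j)

Leftmost-resp : ∀ {n x} {P Q : Fin n → Set} →
  (∀ {j} → P j → Q j) → (∀ {j} → Q j → P j) → Leftmost P x → Leftmost Q x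
Leftmost-resp to from (none ¬P)     = none (¬P ∘ from)
Leftmost-resp to from (some Pj min) = some (to Pj) (min ∘ from)

find-sorted : ∀ {n} {P : Fin n → Set} (P? : Decidable P) {xs} → AllPairs Fin._<_ xs →
              Leftmost (λ j → j ∈ xs × P j) (find P? xs)
find-sorted P? [] = none λ ()
find-sorted P? {x ∷ xs} (x<xs ∷ sorted) with P? x
... | yes Px = some (here refl , Px) λ
  { (here refl , _)  → ℕ.≤-refl
  ; (there k∈xs , _) → ℕ.<⇒≤ (All.lookup x<xs k∈xs) }
... | no ¬Px = Leftmost-resp (λ (j∈ , Pj) → there j∈ , Pj)
  (λ { (here refl , Px) → contradiction Px ¬Px ; (there j∈ , Pj) → j∈ , Pj })
  (find-sorted P? sorted)

find-allFin : ∀ {n} {P : Fin n → Set} (P? : Decidable P) → Leftmost P (find P? (allFin n))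
find-allFin P? = Leftmost-resp proj₂ (∈-allFin _ ,_) (find-sorted P? (AllPairs.tabulate⁺-< id))

module _ {n} (G : Graph n) (σ : Ordering n) where

  -- By definition the search inside `leftmostLeft`, so that `leftmostLeft G σ i` is
  -- `maybe′ vertexNumber -1ℤ (leftNbr i)`.
  leftNbr : Fin n → Maybe (Fin n)
  leftNbr i = find (earlierNbr? G σ (toℕ i) (vertexAt σ i)) (allFin n)

  leftNbr-leftmost : ∀ i → Leftmost (EarlierNbr G σ (toℕ i) (vertexAt σ i)) (leftNbr i)
  leftNbr-leftmost i = find-allFin (earlierNbr? G σ (toℕ i) (vertexAt σ i))

  root : Fin n → Fin n
  root i = fromMaybe i (leftNbr i)

  LeftNbrsMonotone RootsMonotone : Set
  LeftNbrsMonotone = ∀ {i j a b} → i Fin.< j → leftNbr i ≡ just a → leftNbr j ≡ just b → a Fin.≤ b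
  RootsMonotone    = ∀ {i j} → i Fin.< j → root i Fin.≤ root j

  root-≤ : ∀ i → root i Fin.≤ i
  root-≤ i with leftNbr i | leftNbr-leftmost i
  ... | nothing | _                   = ℕ.≤-refl
  ... | just _  | some (j<i , _) _ = ℕ.<⇒≤ j<i

  root-minimal : ∀ {i k} → k Fin.< i → Adj G (vertexAt σ i) (vertexAt σ k) → root i Fin.≤ k
  root-minimal {i} k<i adj with leftNbr i | leftNbr-leftmost i
  ... | nothing | none ¬earlier = contradiction (k<i , adj) ¬earlier
  ... | just _  | some _ min    = min (k<i , adj)

  leftNbr-earlier : ∀ {i j} → leftNbr i ≡ just j → EarlierNbr G σ (toℕ i) (vertexAt σ i) j
  leftNbr-earlier {i} eq with leftNbr i | leftNbr-leftmost i
  leftNbr-earlier refl | just _ | some earlier _ = earlier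

  root-earlier : ∀ {i} → root i Fin.< i → leftNbr i ≡ just (root i)
  root-earlier {i} root<i with leftNbr i
  ... | nothing = contradiction root<i (ℕ.<-irrefl refl)
  ... | just _  = refl

  -- If `i` is at most the root of `j`, then `root i ≤ i` suffices; otherwise that root is a genuine
  -- left neighbour before `i`, to which the condition applies.
  BFSCondition⇒RootsMonotone : BFSCondition G σ → RootsMonotone
  BFSCondition⇒RootsMonotone cond {i} {j} i<j with ℕ.≤-<-connex (toℕ i) (toℕ (root j))
  ... | inj₁ i≤rj = ℕ.≤-trans (root-≤ i) i≤rj
  ... | inj₂ rj<i =
    let l , l≤rj , adj = cond (ℕ.<⇒≤ i<j) rj<i (proj₂ (leftNbr-earlier (root-earlier (ℕ.<-trans rj<i i<j))))
    in ℕ.≤-trans (root-minimal (ℕ.≤-<-trans l≤rj rj<i) adj) l≤rj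

  -- `root i` serves as `l`: monotonicity bounds it by `k`, and being below `i` it is a neighbour
  -- and not the default value.
  RootsMonotone⇒BFSCondition : RootsMonotone → BFSCondition G σ
  RootsMonotone⇒BFSCondition mono {i} {j} {k} i≤j k<i adj = root i , ri≤k ,
    proj₂ (leftNbr-earlier (root-earlier (ℕ.≤-<-trans ri≤k k<i)))
    where
    ri≤k : root i Fin.≤ k
    ri≤k with ℕ.m≤n⇒m<n∨m≡n i≤j
    ... | inj₁ i<j = ℕ.≤-trans (mono i<j) (root-minimal (ℕ.<-≤-trans k<i i≤j) adj)
    ... | inj₂ i≡j with refl ← Fin.toℕ-injective i≡j = root-minimal k<i adj

  BFS⇔RootsMonotone : IsBFSOrdering G σ ⇔ RootsMonotone
  BFS⇔RootsMonotone = mk⇔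
    (BFSCondition⇒RootsMonotone ∘ Equivalence.to (BFS⇔condition G σ))
    (Equivalence.from (BFS⇔condition G σ) ∘ RootsMonotone⇒BFSCondition)

  RootsMonotone⇒LeftNbrsMonotone : RootsMonotone → LeftNbrsMonotone
  RootsMonotone⇒LeftNbrsMonotone mono {i} {j} i<j eqᵢ eqⱼ =
    subst₂ (λ x y → fromMaybe i x Fin.≤ fromMaybe j y) eqᵢ eqⱼ (mono i<j)

  LeftNbrsMonotone⇒RootsMonotone : GENCondition G σ → LeftNbrsMonotone → RootsMonotone
  LeftNbrsMonotone⇒RootsMonotone gen mono {i} {j} i<j with ℕ.≤-<-connex (toℕ i) (toℕ (root j))
  ... | inj₁ i≤rj = ℕ.≤-trans (root-≤ i) i≤rj
  ... | inj₂ rj<i =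
    let eqⱼ          = root-earlier (ℕ.<-trans rj<i i<j)
        -- The root of `j` lies before `i`, so the vertex at `i` has a left neighbour too, and both
        -- roots are actual ln values.
        l , l<i , adj = gen (ℕ.<⇒≤ i<j) rj<i (proj₂ (leftNbr-earlier eqⱼ))
    in mono i<j (root-earlier (ℕ.≤-<-trans (root-minimal l<i adj) l<i)) eqⱼ

  GEN⇒BFS⇔LeftNbrsMonotone : IsGENOrdering G σ → IsBFSOrdering G σ ⇔ LeftNbrsMonotone
  GEN⇒BFS⇔LeftNbrsMonotone gen = mk⇔
    (RootsMonotone⇒LeftNbrsMonotone ∘ Equivalence.to BFS⇔RootsMonotone)
    (Equivalence.from BFS⇔RootsMonotone ∘ LeftNbrsMonotone⇒RootsMonotone (GEN⇒condition G σ gen))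

-- Programs with bounded running time

-- A record rather than an equation, so that the test can be inferred.
record Evaluates (S : State) (b : Test) (x : Bool) : Set where
  constructor evaluates
  field value : ⟦ b ⟧ᵗ S ≡ x

infix 2 ⟨_,_⟩⇓_within_

-- Upper bounds in place of exact costs let the branches of a conditional share one figure.
⟨_,_⟩⇓_within_ : Stmt → State → Outcome → ℕ → Set
⟨ p , S ⟩⇓ o within b = ∃ λ t → (⟨ p , S ⟩⇓ o cost t) × t ≤ b

module _ {S : State} where

  weaken : ∀ {p o b c} → b ≤ c → ⟨ p , S ⟩⇓ o within b → ⟨ p , S ⟩⇓ o within c
  weaken b≤c (t , run , t≤b) = t , run , ℕ.≤-trans t≤b b≤c

  exactly : ∀ {p o t} → ⟨ p , S ⟩⇓ o cost t → ⟨ p , S ⟩⇓ o within t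
  exactly run = _ , run , ℕ.≤-refl

  setReg-within : ∀ {r e z} → ⟦ e ⟧ᵉ S ≡ z →
    ⟨ r ≔ e , S ⟩⇓ running (setReg r z S) within suc (costᵉ e)
  setReg-within refl = exactly ⇓reg

  setArr-within : ∀ {a e f k z} → ⟦ e ⟧ᵉ S ≡ k → ⟦ f ⟧ᵉ S ≡ z →
    ⟨ a ⟨ e ⟩≔ f , S ⟩⇓ running (setArr a k z S) within suc (costᵉ e + costᵉ f)
  setArr-within refl refl = exactly ⇓arr

  seq-within : ∀ {p q S′ o b c} → ⟨ p , S ⟩⇓ running S′ within b → ⟨ q , S′ ⟩⇓ o within c →
    ⟨ p ⨾ q , S ⟩⇓ o within b + c
  seq-within (_ , run , t≤b) (_ , run′ , u≤c) = _ , ⇓seq run run′ , ℕ.+-mono-≤ t≤b u≤c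

  seq-returned-within : ∀ {p q x b} → ⟨ p , S ⟩⇓ returned x within b → ⟨ p ⨾ q , S ⟩⇓ returned x within b
  seq-returned-within (_ , run , t≤b) = _ , ⇓seq-returned run , t≤b

  if-true-within : ∀ {b p q o c} → Evaluates S b true → ⟨ p , S ⟩⇓ o within c →
    ⟨ If b Then p Else q , S ⟩⇓ o within costᵗ b + c
  if-true-within {b} (evaluates eq) (_ , run , t≤c) = _ , ⇓if-true eq run , ℕ.+-monoʳ-≤ (costᵗ b) t≤c

  if-false-within : ∀ {b p q o c} → Evaluates S b false → ⟨ q , S ⟩⇓ o within c →
    ⟨ If b Then p Else q , S ⟩⇓ o within costᵗ b + c
  if-false-within {b} (evaluates eq) (_ , run , t≤c) = _ , ⇓if-false eq run , ℕ.+-monoʳ-≤ (costᵗ b) t≤c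

  while-false-within : ∀ {b p} → Evaluates S b false →
    ⟨ While b Do p , S ⟩⇓ running S within costᵗ b
  while-false-within (evaluates eq) = exactly (⇓while-false eq)

  while-true-within : ∀ {b p S′ o c d} → Evaluates S b true →
    ⟨ p , S ⟩⇓ running S′ within c → ⟨ While b Do p , S′ ⟩⇓ o within d →
    ⟨ While b Do p , S ⟩⇓ o within costᵗ b + (c + d)
  while-true-within {b} (evaluates eq) (_ , run , t≤c) (_ , run′ , u≤d) =
    _ , ⇓while-true eq run run′ , ℕ.+-monoʳ-≤ (costᵗ b) (ℕ.+-mono-≤ t≤c u≤d)

  while-returned-within : ∀ {b p x c} → Evaluates S b true → ⟨ p , S ⟩⇓ returned x within c →
    ⟨ While b Do p , S ⟩⇓ returned x within costᵗ b + c
  while-returned-within {b} (evaluates eq) (_ , run , t≤c) = _ , ⇓while-returned eq run , ℕ.+-monoʳ-≤ (costᵗ b) t≤c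

  module _ {e f x y} (e≡x : ⟦ e ⟧ᵉ S ≡ x) (f≡y : ⟦ f ⟧ᵉ S ≡ y) where

    >ᵉ-true : y ℤ.< x → Evaluates S (e >ᵉ f) true
    >ᵉ-true y<x = evaluates (trans (cong₂ (λ x y → does (y ℤ.<? x)) e≡x f≡y) (dec-true (y ℤ.<? x) y<x))

    >ᵉ-false : x ℤ.≤ y → Evaluates S (e >ᵉ f) false
    >ᵉ-false x≤y = evaluates (trans (cong₂ (λ x y → does (y ℤ.<? x)) e≡x f≡y) (dec-false (y ℤ.<? x) (ℤ.≤⇒≯ x≤y)))

    ≢ᵉ-true : x ≢ y → Evaluates S (e ≢ᵉ f) true
    ≢ᵉ-true x≢y = evaluates (trans (cong₂ (λ x y → not (does (x ℤ.≟ y))) e≡x f≡y)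
                             (cong not (dec-false (x ℤ.≟ y) x≢y)))

    ≢ᵉ-false : x ≡ y → Evaluates S (e ≢ᵉ f) false
    ≢ᵉ-false x≡y = evaluates (trans (cong₂ (λ x y → not (does (x ℤ.≟ y))) e≡x f≡y)
                             (cong not (dec-true (x ℤ.≟ y) x≡y)))

-- A checking loop never answers YES itself: it establishes `P` and falls through, or returns NO
-- with a refutation of `P`.
data Refutes (P : Set) : Outcome → Set where
  passed : ∀ {S} → P → Refutes P (running S)
  failed : ¬ P → Refutes P (returned NO)

answering : ∀ {P p S b} → (∃ λ o → (⟨ p , S ⟩⇓ o within b) × Refutes P o) →
  ∃ λ answer → (⟨ p ⨾ return YES , S ⟩⇓ returned answer within b + 1) × (answer ≡ YES ⇔ P)
answering {b = b} (_ , run , passed P) = YES , seq-within run (exactly ⇓return) , mk⇔ (λ _ → P) (λ _ → refl)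
answering {b = b} (_ , run , failed ¬P) = NO , seq-returned-within (weaken (ℕ.m≤m+n b 1) run) ,
  mk⇔ (λ ()) (λ P → contradiction P ¬P)

-- BFS-check

bfsCheckTest : Test
bfsCheckTest = reg iᴿ >ᵉ lit 0ℤ

bfsCheckBody : Stmt
bfsCheckBody =
  If lnᴬ at reg iᴿ >ᵉ reg minᴿ Then return NO Else skip ⨾
  If lnᴬ at reg iᴿ ≢ᵉ lit -1ℤ Then minᴿ ≔ lnᴬ at reg iᴿ Else skip ⨾
  iᴿ ≔ dec (reg iᴿ)

module _ {n} (G : Graph n) (σ : Ordering n) where

  private
    left : Fin n → Maybe (Fin n)
    left = leftNbr G σ

  -- `p` is the content of `iᴿ`, so the positions already treated are those of index at least `p`.
  -- By `min-lower` and `min-value`, `m` is the least ln value other than -1 among them, or `n` if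
  -- there is none.
  record BfsCheckInvariant (p m : ℕ) (S : State) : Set where
    field
      min-reg   : regs S minᴿ ≡ + m
      i-reg     : regs S iᴿ ≡ + p
      ln-array  : ∀ i → arrs S lnᴬ (vertexNumber i) ≡ leftmostLeft G σ i
      monotone  : ∀ {i j a b} → p ≤ toℕ i → i Fin.< j → left i ≡ just a → left j ≡ just b → a Fin.≤ b
      min-lower : ∀ {j b} → p ≤ toℕ j → left j ≡ just b → m ≤ suc (toℕ b)
      min-value : m ≡ n ⊎ ∃₂ λ j b → p ≤ toℕ j × left j ≡ just b × m ≡ suc (toℕ b)

  -- An iteration costs at most 18 = 3 + 5 + 7 + 3: loop test, comparison, update of the minimum,
  -- decrement. The final 3 is the failing loop test.
  BfsCheckFrom : ℕ → State → Set
  BfsCheckFrom p S = ∃ λ o →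
    (⟨ While bfsCheckTest Do bfsCheckBody , S ⟩⇓ o within p * 18 + 3) × Refutes (LeftNbrsMonotone G σ) o

  -- The running minimum detects every violation: NO exhibits a later position with a smaller ln,
  -- while a value not above the minimum is at most all later ones and becomes the new minimum.
  bfsCheck-step : ∀ i {m S} → BfsCheckInvariant (suc (toℕ i)) m S →
    (∀ {m S} → BfsCheckInvariant (toℕ i) m S → BfsCheckFrom (toℕ i) S) → BfsCheckFrom (suc (toℕ i)) S
  bfsCheck-step i {m} {S} inv continue = step (left i) refl
    where
    open BfsCheckInvariant inv
    test : Evaluates S bfsCheckTest true
    test = >ᵉ-true i-reg refl (ℤ.+<+ (s≤s z≤n))
    ln≡ : ∀ {x} → left i ≡ x → ⟦ lnᴬ at reg iᴿ ⟧ᵉ S ≡ maybe′ vertexNumber -1ℤ x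
    ln≡ eq = trans (cong (arrs S lnᴬ) i-reg) (trans (ln-array i) (cong (maybe′ vertexNumber -1ℤ) eq))

    step : ∀ x → left i ≡ x → BfsCheckFrom (suc (toℕ i)) S
    step nothing eq =
      let _ , run , verdict = continue inv′
      in _
       , weaken (ℕ.m≤n+m _ 2) (while-true-within test
           (seq-within (if-false-within (>ᵉ-false (ln≡ eq) min-reg ℤ.-≤+) (exactly ⇓skip))
           (seq-within (if-false-within (≢ᵉ-false (ln≡ eq) refl refl) (exactly ⇓skip))
           (setReg-within (cong ℤ.pred i-reg)))) run)
       , verdict
      where
      later : ∀ {j b} → toℕ i ≤ toℕ j → left j ≡ just b → toℕ i < toℕ j
      later i≤j eqⱼ with ℕ.m≤n⇒m<n∨m≡n i≤j
      ... | inj₁ i<j = i<j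
      ... | inj₂ i≡j with refl ← Fin.toℕ-injective i≡j with () ← trans (sym eq) eqⱼ
      inv′ : BfsCheckInvariant (toℕ i) m (setReg iᴿ (+ toℕ i) S)
      inv′ = record
        { min-reg   = min-reg
        ; i-reg     = refl
        ; ln-array  = ln-array
        ; monotone  = λ i≤j j<k eqⱼ → monotone (later i≤j eqⱼ) j<k eqⱼ
        ; min-lower = λ i≤j eqⱼ → min-lower (later i≤j eqⱼ) eqⱼ
        ; min-value = Sum.map₂ (λ (j , b , i<j , rest) → j , b , ℕ.<⇒≤ i<j , rest) min-value
        }
    step (just a) eq with ℕ.≤-<-connex (suc (toℕ a)) m
    ... | inj₂ m<a = _
        , weaken (ℕ.m≤m+n 8 _) (while-returned-within test
            (seq-returned-within (if-true-within (>ᵉ-true (ln≡ eq) min-reg (ℤ.+<+ m<a)) (exactly ⇓return))))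
        , failed (λ mono → violated mono min-value)
      where
      violated : LeftNbrsMonotone G σ → ¬ (m ≡ n ⊎ ∃₂ λ j b → toℕ i < toℕ j × left j ≡ just b × m ≡ suc (toℕ b))
      -- The initial minimum `n` is never exceeded, since ln values are at most `n`.
      violated _    (inj₁ refl) = ℕ.<⇒≱ m<a (Fin.toℕ<n a)
      violated mono (inj₂ (j , b , i<j , eqⱼ , refl)) = ℕ.<⇒≱ m<a (s≤s (mono i<j eq eqⱼ))
    ... | inj₁ a≤m =
      let _ , run , verdict = continue inv′
      in _
       , while-true-within test
           (seq-within (if-false-within (>ᵉ-false (ln≡ eq) min-reg (ℤ.+≤+ a≤m)) (exactly ⇓skip))
           (seq-within (if-true-within (≢ᵉ-true (ln≡ eq) refl (λ ())) (setReg-within (ln≡ eq)))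
           (setReg-within (cong ℤ.pred i-reg)))) run
       , verdict
      where
      inv′ : BfsCheckInvariant (toℕ i) (suc (toℕ a)) (setReg iᴿ (+ toℕ i) (setReg minᴿ (vertexNumber a) S))
      inv′ = record
        { min-reg   = refl
        ; i-reg     = refl
        ; ln-array  = ln-array
        ; monotone  = mono
        ; min-lower = lower
        ; min-value = inj₂ (i , a , ℕ.≤-refl , eq , refl)
        }
        where
        lower : ∀ {j b} → toℕ i ≤ toℕ j → left j ≡ just b → suc (toℕ a) ≤ suc (toℕ b)
        lower i≤j eqⱼ with ℕ.m≤n⇒m<n∨m≡n i≤j
        ... | inj₁ i<j = ℕ.≤-trans a≤m (min-lower i<j eqⱼ)
        ... | inj₂ i≡j with refl ← Fin.toℕ-injective i≡j with refl ← trans (sym eq) eqⱼ = ℕ.≤-refl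
        mono : ∀ {j k b c} → toℕ i ≤ toℕ j → j Fin.< k → left j ≡ just b → left k ≡ just c → b Fin.≤ c
        mono i≤j j<k eqⱼ eqₖ with ℕ.m≤n⇒m<n∨m≡n i≤j
        ... | inj₁ i<j = monotone i<j j<k eqⱼ eqₖ
        ... | inj₂ i≡j with refl ← Fin.toℕ-injective i≡j with refl ← trans (sym eq) eqⱼ =
          ℕ.s≤s⁻¹ (lower (ℕ.<⇒≤ j<k) eqₖ)

  bfsCheck-loop : ∀ p {m S} → p ≤ n → BfsCheckInvariant p m S → BfsCheckFrom p S
  bfsCheck-loop zero _ inv =
    _ , while-false-within (>ᵉ-false i-reg refl (ℤ.+≤+ z≤n)) , passed (monotone z≤n)
    where open BfsCheckInvariant inv
  bfsCheck-loop (suc p) p<n inv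
    with continue ← (λ {m} {S} → bfsCheck-loop p {m} {S} (ℕ.<⇒≤ p<n))
    with i , refl ← position p<n = bfsCheck-step i inv continue

arrayOf-tabulate : ∀ {n} (f : Fin n → ℤ) i → arrayOf (tabulate f) (vertexNumber i) ≡ f i
arrayOf-tabulate f Fin.zero    = refl
arrayOf-tabulate f (Fin.suc i) = arrayOf-tabulate (f ∘ Fin.suc) i

bfsCheck-correct : ∀ {n} (G : Graph n) (σ : Ordering n) → IsGENOrdering G σ →
  ∃₂ λ answer t →
    (⟨ bfsCheck , leftmostLeftInput G σ ⟩⇓ returned answer cost t) ×
    (answer ≡ YES ⇔ IsBFSOrdering G σ) ×
    (1 ≤ n → t ≤ 26 * n)
bfsCheck-correct {n} G σ gen =
  let answer , run , answer⇔ = answering (bfsCheck-loop G σ n ℕ.≤-refl (record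
        { min-reg   = refl
        ; i-reg     = refl
        ; ln-array  = arrayOf-tabulate (leftmostLeft G σ)
        ; monotone  = λ {i} n≤i → contradiction n≤i (ℕ.<⇒≱ (Fin.toℕ<n i))
        ; min-lower = λ {j} n≤j → contradiction n≤j (ℕ.<⇒≱ (Fin.toℕ<n j))
        ; min-value = inj₁ refl
        }))
      t , run′ , t≤ = seq-within (setReg-within refl) (seq-within (setReg-within refl) run)
      BFS⇔ = GEN⇒BFS⇔LeftNbrsMonotone G σ gen
  in answer , t , run′ ,
     mk⇔ (Equivalence.from BFS⇔ ∘ Equivalence.to answer⇔) (Equivalence.from answer⇔ ∘ Equivalence.to BFS⇔) ,
     -- The 8 operations outside the iterations (two assignments, last test, return) are at most 8n
     -- because n is positive; hence 26 = 18 + 8.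
     λ 1≤n → ℕ.≤-trans t≤ (begin
       2 + (2 + (n * 18 + 3 + 1)) ≡⟨ solve 1 (λ n → con 2 :+ (con 2 :+ (n :* con 18 :+ con 3 :+ con 1))
                                       := con 18 :* n :+ con 8 :* con 1) refl n ⟩
       18 * n + 8 * 1             ≤⟨ ℕ.+-monoʳ-≤ (18 * n) (ℕ.*-monoʳ-≤ 8 1≤n) ⟩
       18 * n + 8 * n             ≡⟨ ℕ.*-distribʳ-+ n 18 8 ⟨
       26 * n                     ∎)
  where
  open ℕ.≤-Reasoning
  open +-*-Solver

-- Counting edges

-- Pigeonhole by induction: delete the head of `xs` from `ys`; by distinctness the tail stays inside
-- what remains.
unique-⊆-length : ∀ {A : Set} {xs ys : List A} → Unique xs → xs ⊆ ys → length xs ≤ length ys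
unique-⊆-length [] _ = z≤n
unique-⊆-length {xs = x ∷ xs} (x∉xs ∷ unique) xs⊆ys
  with as , bs , refl ← ∈-∃++ (xs⊆ys (here refl)) = begin
    suc (length xs)                ≤⟨ s≤s (unique-⊆-length unique xs⊆) ⟩
    suc (length (as ++ bs))        ≡⟨ cong suc (List.length-++ as) ⟩
    suc (length as + length bs)    ≡⟨ ℕ.+-suc (length as) (length bs) ⟨
    length as + length (x ∷ bs)    ≡⟨ List.length-++ as ⟨
    length (as ++ x ∷ bs)          ∎
  where
  open ℕ.≤-Reasoning
  xs⊆ : xs ⊆ as ++ bs
  xs⊆ y∈xs with ∈-++⁻ as (xs⊆ys (there y∈xs))
  ... | inj₁ y∈as         = ∈-++⁺ˡ y∈as
  ... | inj₂ (here refl)  = contradiction refl (All.lookup x∉xs y∈xs)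
  ... | inj₂ (there y∈bs) = ∈-++⁺ʳ as y∈bs

drop-tabulate : ∀ {A : Set} {n} (f : Fin n → A) i →
  drop (toℕ i) (tabulate f) ≡ f i ∷ drop (suc (toℕ i)) (tabulate f)
drop-tabulate f Fin.zero    = refl
drop-tabulate f (Fin.suc i) = drop-tabulate (f ∘ Fin.suc) i

length-concat-tabulate : ∀ {A B : Set} {n} (f : Fin n → List A) (g : Fin n → List B) →
  (∀ i → length (f i) ≡ length (g i)) → length (concat (tabulate f)) ≡ length (concat (tabulate g))
length-concat-tabulate {n = zero}  f g eq = refl
length-concat-tabulate {n = suc n} f g eq = begin
  length (concat (tabulate f))                               ≡⟨ List.length-++ (f Fin.zero) ⟩
  length (f Fin.zero) + length (concat (tabulate (f ∘ Fin.suc)))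
    ≡⟨ cong₂ _+_ (eq Fin.zero) (length-concat-tabulate _ _ (eq ∘ Fin.suc)) ⟩
  length (g Fin.zero) + length (concat (tabulate (g ∘ Fin.suc))) ≡⟨ List.length-++ (g Fin.zero) ⟨
  length (concat (tabulate g))                               ∎
  where open ≡-Reasoning

module _ {n} {G : Graph n} (L : AdjacencyLists G) (σ : Ordering n) where

  open AdjacencyLists L

  nbrsAt : Fin n → List (Fin n)
  nbrsAt i = nbrs (vertexAt σ i)

  -- The number of adjacency entries still to be scanned when position `p` is reached: the amortised
  -- budget of the inner loop.
  work : ℕ → ℕ
  work p = length (concat (drop p (tabulate nbrsAt)))

  work-step : ∀ i → work (toℕ i) ≡ length (nbrsAt i) + work (suc (toℕ i))
  work-step i = trans (cong (length ∘ concat) (drop-tabulate nbrsAt i)) (List.length-++ (nbrsAt i))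

  private
    -- Different adjacency lists may share entries; pairing each entry with its source makes all of
    -- them distinct.
    arcsAt : Fin n → List (Fin n × Fin n)
    arcsAt i = map (vertexAt σ i ,_) (nbrsAt i)

    edges : List (Fin n × Fin n)
    edges = filter (λ (u , v) → (u Fin.<? v) ×-dec adj? G u v) (cartesianProduct (allFin n) (allFin n))

    arcs-unique : Unique (concat (tabulate arcsAt))
    arcs-unique = Unique.concat⁺
      (All.tabulate⁺ λ i → Unique.map⁺ (λ { refl → refl }) (unique (vertexAt σ i)))
      (AllPairs.tabulate⁺ λ i≢j (∈i , ∈j) → i≢j (vertexAt-injective σ (trans (sym (source ∈i)) (source ∈j))))
      where
      source : ∀ {i a} → a ∈ arcsAt i → proj₁ a ≡ vertexAt σ i
      source ∈i with _ , _ , refl ← ∈-map⁻ _ ∈i = refl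

    edge : ∀ {u v} → u Fin.< v → Adj G u v → (u , v) ∈ edges
    edge u<v adj = ∈-filter⁺ _ (∈-cartesianProduct⁺ (∈-allFin _) (∈-allFin _)) (u<v , adj)

    arcs-⊆ : concat (tabulate arcsAt) ⊆ edges ++ map swap edges
    arcs-⊆ ∈arcs
      with _ , ∈xs , xs∈ ← ∈-concat⁻′ (tabulate arcsAt) ∈arcs
      with i , refl ← ∈-tabulate⁻ xs∈
      with v , v∈ , refl ← ∈-map⁻ _ ∈xs
      with adj ← Equivalence.to (complete _ v) v∈
      with Fin.<-cmp (vertexAt σ i) v
    ... | tri< u<v _ _ = ∈-++⁺ˡ (edge u<v adj)
    ... | tri≈ _ u≡v _ = contradiction adj (irrefl G u≡v)
    ... | tri> _ _ v<u = ∈-++⁺ʳ edges (∈-map⁺ swap (edge v<u (symm G adj)))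

  work≤2m : work 0 ≤ 2 * edgeCount G
  work≤2m = begin
    length (concat (tabulate nbrsAt))
      ≡⟨ length-concat-tabulate nbrsAt arcsAt (λ i → sym (List.length-map _ (nbrsAt i))) ⟩
    length (concat (tabulate arcsAt)) ≤⟨ unique-⊆-length arcs-unique arcs-⊆ ⟩
    length (edges ++ map swap edges)  ≡⟨ List.length-++ edges ⟩
    edgeCount G + length (map swap edges)
      ≡⟨ cong (λ k → edgeCount G + k) (trans (List.length-map swap edges) (sym (ℕ.+-identityʳ _))) ⟩
    2 * edgeCount G                   ∎
    where open ℕ.≤-Reasoning

-- The check of an arbitrary ordering

update-same : ∀ {A B : Set} (_≟_ : DecidableEquality A) (f : A → B) a b → update _≟_ f a b a ≡ b
update-same _≟_ f a b rewrite dec-true (a ≟ a) refl = refl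

update-other : ∀ {A B : Set} (_≟_ : DecidableEquality A) (f : A → B) {a} b {x} → x ≢ a → update _≟_ f a b x ≡ f x
update-other _≟_ f {a} b {x} x≢a rewrite dec-false (x ≟ a) x≢a = refl

vertexNumber-injective : ∀ {n} {u v : Fin n} → vertexNumber u ≡ vertexNumber v → u ≡ v
vertexNumber-injective = Fin.toℕ-injective ∘ ℕ.suc-injective ∘ ℤ.+-injective

arrayOf-map-++ : ∀ {A : Set} (f : A → ℤ) xs {y ys} → arrayOf (map f (xs ++ y ∷ ys)) +[1+ length xs ] ≡ f y
arrayOf-map-++ f []       = refl
arrayOf-map-++ f (_ ∷ xs) = arrayOf-map-++ f xs

offsets : ∀ {A : Set} → ℕ → List (List A) → List ℕ
offsets = scanl (λ k xs → k + length xs)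

-- Two consecutive offsets delimit the list of `v`. The first offset `k` is arbitrary for the
-- induction, which adds the length of the first list to it; the input has `k` = 1.
concat-at : ∀ {A : Set} {m} (f : Fin m → List A) k v → ∃₂ λ pre post →
  concat (tabulate f) ≡ pre ++ f v ++ post ×
  arrayOf (map +_ (offsets k (tabulate f))) (vertexNumber v) ≡ + (k + length pre) ×
  arrayOf (map +_ (offsets k (tabulate f))) (ℤ.suc (vertexNumber v)) ≡ + (k + length pre + length (f v))
concat-at f k Fin.zero = [] , _ , refl , cong +_ (sym (ℕ.+-identityʳ k)) ,
  cong (λ l → + (l + length (f Fin.zero))) (sym (ℕ.+-identityʳ k))
concat-at f k (Fin.suc v)
  with pre , post , split , start , end ← concat-at (f ∘ Fin.suc) (k + length (f Fin.zero)) v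
  = f Fin.zero ++ pre , post
  , trans (cong (f Fin.zero ++_) split) (sym (List.++-assoc (f Fin.zero) pre _))
  , trans start (cong +_ shift)
  , trans end (cong (λ l → + (l + length (f (Fin.suc v)))) shift)
  where
  shift : k + length (f Fin.zero) + length pre ≡ k + length (f Fin.zero ++ pre)
  shift = trans (ℕ.+-assoc k _ _) (cong (λ l → k + l) (sym (List.length-++ (f Fin.zero))))

Leftmost-unique : ∀ {n x y} {P : Fin n → Set} → Leftmost P x → Leftmost P y → x ≡ y
Leftmost-unique (none ¬P)     (none _)      = refl
Leftmost-unique (none ¬P)     (some Pj _)   = contradiction Pj ¬P
Leftmost-unique (some Pj _)   (none ¬P)     = contradiction Pj ¬P
Leftmost-unique (some Pj min) (some Pk min′) = cong just (Fin.≤-antisym (min Pk) (min′ Pj))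

-- No element of `P` lies after `i`, so adding `i` changes the leftmost one only if there was none.
-- This is why marking may keep an existing mark.
Leftmost-extend : ∀ {n x i} {P : Fin n → Set} → (∀ {j} → P j → j Fin.≤ i) → Leftmost P x →
  Leftmost (λ j → P j ⊎ j ≡ i) (just (fromMaybe i x))
Leftmost-extend P≤i (none ¬P)     = some (inj₂ refl) λ { (inj₁ Pk) → contradiction Pk ¬P ; (inj₂ refl) → ℕ.≤-refl }
Leftmost-extend P≤i (some Pj min) = some (inj₁ Pj) λ { (inj₁ Pk) → min Pk ; (inj₂ refl) → P≤i Pj }

-- At the time a position i is reached, firstᴬ holds for every vertex the
-- position of its leftmost neighbour before i, or 0 if there is none.  With i
-- itself in place of 0 this gives the root of the vertex at i.

maxᴿ vᴿ rootᴿ kᴿ : Reg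
maxᴿ  = 3
vᴿ    = 4
rootᴿ = 5
kᴿ    = 6

firstᴬ : Arr
firstᴬ = 4

-- Serves twice: for the current vertex it gives the root, for a neighbour the content of its cell
-- after marking. The value 0 can mean "no mark" because positions count from 1.
loadRoot : Expr → Stmt
loadRoot e = If firstᴬ at e ≢ᵉ lit 0ℤ Then rootᴿ ≔ firstᴬ at e Else rootᴿ ≔ reg iᴿ

scanTest : Test
scanTest = offsetᴬ at inc (reg vᴿ) >ᵉ reg kᴿ

scanBody : Stmt
scanBody =
  loadRoot (targetᴬ at reg kᴿ) ⨾
  firstᴬ ⟨ targetᴬ at reg kᴿ ⟩≔ reg rootᴿ ⨾
  kᴿ ≔ inc (reg kᴿ)

orderTest : Test
orderTest = inc (reg sizeᴿ) >ᵉ reg iᴿ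

orderBody : Stmt
orderBody =
  vᴿ ≔ orderᴬ at reg iᴿ ⨾
  loadRoot (reg vᴿ) ⨾
  If reg maxᴿ >ᵉ reg rootᴿ Then return NO Else maxᴿ ≔ reg rootᴿ ⨾
  kᴿ ≔ offsetᴬ at reg vᴿ ⨾
  While scanTest Do scanBody ⨾
  iᴿ ≔ inc (reg iᴿ)

bfsOrderingCheck : Stmt
bfsOrderingCheck = iᴿ ≔ lit +[1+ 0 ] ⨾ While orderTest Do orderBody ⨾ return YES

loadRoot-within : ∀ {n S e k} x {i : Fin n} →
  ⟦ e ⟧ᵉ S ≡ k → arrs S firstᴬ k ≡ maybe′ vertexNumber 0ℤ x → regs S iᴿ ≡ vertexNumber i →
  ⟨ loadRoot e , S ⟩⇓ running (setReg rootᴿ (vertexNumber (fromMaybe i x)) S)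
    within costᵗ (firstᴬ at e ≢ᵉ lit 0ℤ) + (2 + costᵉ e)
loadRoot-within (just j) refl first≡ i≡ =
  if-true-within (≢ᵉ-true first≡ refl λ ()) (setReg-within first≡)
loadRoot-within nothing refl first≡ i≡ =
  if-false-within (≢ᵉ-false first≡ refl refl) (weaken (ℕ.m≤m+n 2 _) (setReg-within i≡))

-- Invariants of the pass over the ordering

module _ {n} {G : Graph n} (L : AdjacencyLists G) (σ : Ordering n) where

  open AdjacencyLists L

  private
    input : State
    input = graphInput L σ

  record Registers (p m : ℕ) (S : State) : Set where
    field
      size-reg     : regs S sizeᴿ ≡ + n
      i-reg        : regs S iᴿ ≡ +[1+ p ]
      max-reg      : regs S maxᴿ ≡ + m
      order-array  : arrs S orderᴬ ≡ arrs input orderᴬ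
      offset-array : arrs S offsetᴬ ≡ arrs input offsetᴬ
      target-array : arrs S targetᴬ ≡ arrs input targetᴬ

  next-position : ∀ {p m S} → Registers p m S → Registers (suc p) m (setReg iᴿ (+ suc (suc p)) S)
  next-position registers = record
    { size-reg = size-reg ; i-reg = refl ; max-reg = max-reg
    ; order-array = order-array ; offset-array = offset-array ; target-array = target-array }
    where open Registers registers

  -- `Q` is a parameter because in the middle of a scan the marks lie between the earlier neighbours
  -- for one bound and those for the next.
  FirstArray : (Fin n → Fin n → Set) → State → Set
  FirstArray Q S = ∀ w → ∃ λ x → arrs S firstᴬ (vertexNumber w) ≡ maybe′ vertexNumber 0ℤ x × Leftmost (Q w) x

  -- `pre` is what is stored before the cell in `kᴿ`, and `ws` the rest of the current list. An
  -- entry costs at most 21 = 5 + 9 + 4 + 3: test, load, write, increment; the failing test costs 5.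
  scan-loop : ∀ (i : Fin n) ws {Q pre post m S} → (∀ {w j} → Q w j → j Fin.≤ i) →
    Registers (toℕ i) m S → FirstArray Q S →
    concat (tabulate nbrs) ≡ pre ++ ws ++ post →
    regs S kᴿ ≡ + suc (length pre) →
    arrs S offsetᴬ (ℤ.suc (regs S vᴿ)) ≡ + (suc (length pre) + length ws) →
    ∃ λ S′ → (⟨ While scanTest Do scanBody , S ⟩⇓ running S′ within length ws * 21 + 5) ×
      Registers (toℕ i) m S′ × FirstArray (λ w j → Q w j ⊎ (j ≡ i × w ∈ ws)) S′
  scan-loop i [] {pre = pre} Q≤i registers first split k≡ end≡ =
    _ , while-false-within (>ᵉ-false end≡ k≡ (ℤ.+≤+ (ℕ.≤-reflexive (ℕ.+-identityʳ _)))) , registers ,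
    λ w → let x , first≡ , leftmost = first w in
      x , first≡ , Leftmost-resp inj₁ (λ { (inj₁ q) → q ; (inj₂ (_ , ())) }) leftmost
  scan-loop i (w ∷ ws) {Q} {pre} {post} {m} {S} Q≤i registers first split k≡ end≡ =
    let S′ , run , registers′ , first″ = scan-loop i ws {pre = pre ++ w ∷ []} Q′≤i
          (record { size-reg = size-reg ; i-reg = i-reg ; max-reg = max-reg
                  ; order-array = order-array ; offset-array = offset-array ; target-array = target-array })
          first′
          (trans split (sym (List.++-assoc pre (w ∷ []) _)))
          (trans (cong ℤ.suc k≡) (cong (λ l → + suc l) (sym length≡)))
          (trans end≡ (cong +_ (trans (ℕ.+-suc (suc (length pre)) (length ws))
            (cong (λ l → suc (l + length ws)) (sym length≡)))))
    in S′
     , while-true-within (>ᵉ-true end≡ k≡ (ℤ.+<+ (ℕ.m<m+n _ (s≤s z≤n))))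
         (seq-within (loadRoot-within (proj₁ (first w)) target≡ (proj₁ (proj₂ (first w))) i-reg)
         (seq-within (setArr-within target≡ refl)
         (setReg-within refl)))
         run
     , registers′
     , λ u → let x , first≡ , leftmost = first″ u in x , first≡ , Leftmost-resp
         (λ { (inj₁ (inj₁ q)) → inj₁ q
           ; (inj₁ (inj₂ (eq , refl))) → inj₂ (eq , here refl)
           ; (inj₂ (eq , u∈)) → inj₂ (eq , there u∈) })
         (λ { (inj₁ q) → inj₁ (inj₁ q)
           ; (inj₂ (eq , here refl)) → inj₁ (inj₂ (eq , refl))
           ; (inj₂ (eq , there u∈)) → inj₂ (eq , u∈) })
         leftmost
    where
    open Registers registers
    length≡ : length (pre ++ w ∷ []) ≡ suc (length pre)
    length≡ = trans (List.length-++ pre) (ℕ.+-comm _ 1)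
    target≡ : arrs S targetᴬ (regs S kᴿ) ≡ vertexNumber w
    target≡ rewrite target-array | k≡ | split = arrayOf-map-++ vertexNumber pre
    marked : Fin n
    marked = fromMaybe i (proj₁ (first w))
    Q′ : Fin n → Fin n → Set
    Q′ u j = Q u j ⊎ (j ≡ i × u ≡ w)
    Q′≤i : ∀ {u j} → Q′ u j → j Fin.≤ i
    Q′≤i (inj₁ q)          = Q≤i q
    Q′≤i (inj₂ (refl , _)) = ℕ.≤-refl
    first′ : FirstArray Q′ (setArr firstᴬ (vertexNumber w) (vertexNumber marked) S)
    first′ u with u Fin.≟ w
    ... | yes refl = just marked , update-same ℤ._≟_ (arrs S firstᴬ) (vertexNumber w) _ , Leftmost-resp
            (λ { (inj₁ q) → inj₁ q ; (inj₂ eq) → inj₂ (eq , refl) })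
            (λ { (inj₁ q) → inj₁ q ; (inj₂ (eq , _)) → inj₂ eq })
            (Leftmost-extend Q≤i (proj₂ (proj₂ (first w))))
    ... | no u≢w = let x , first≡ , leftmost = first u in
            x , trans (update-other ℤ._≟_ (arrs S firstᴬ) _ (u≢w ∘ vertexNumber-injective)) first≡ ,
            Leftmost-resp inj₁ (λ { (inj₁ q) → q ; (inj₂ (_ , eq)) → contradiction eq u≢w }) leftmost

  OrderFrom : ℕ → State → Set
  OrderFrom b S = ∃ λ o → (⟨ While orderTest Do orderBody , S ⟩⇓ o within b) × Refutes (RootsMonotone G σ) o

  -- `m` is the largest root seen so far, counted from 1, or 0 at the start; comparing the next root
  -- with it alone decides monotonicity.
  record OrderInvariant (p m : ℕ) (S : State) : Set where
    field
      registers : Registers p m S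
      first     : FirstArray (EarlierNbr G σ p) S
      monotone  : ∀ {i j} → i Fin.< j → toℕ j < p → root G σ i Fin.≤ root G σ j
      max-upper : ∀ {i} → toℕ i < p → suc (toℕ (root G σ i)) ≤ m
      max-value : m ≡ 0 ⊎ ∃ λ i → toℕ i < p × m ≡ suc (toℕ (root G σ i))
    open Registers registers public

  -- Apart from the scanned entries, an iteration costs at most 30 = 4 + 3 + 7 + 5 + 3 + 5 + 3,
  -- where the second 5 is the failing test of the scan.
  order-step : ∀ (i : Fin n) {m S b} → OrderInvariant (toℕ i) m S →
    (∀ {m S} → OrderInvariant (suc (toℕ i)) m S → OrderFrom b S) →
    OrderFrom (30 + (length (nbrsAt L σ i) * 21 + b)) S
  order-step i {m} {S} {b} inv continue = step (ℕ.≤-<-connex m (suc (toℕ r)))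
    where
    open OrderInvariant inv
    v = vertexAt σ i
    r = root G σ i
    S₀ = setReg vᴿ (vertexNumber v) S
    S₁ = setReg rootᴿ (vertexNumber r) S₀

    test : Evaluates S orderTest true
    test = >ᵉ-true (cong ℤ.suc size-reg) i-reg (ℤ.+<+ (s≤s (Fin.toℕ<n i)))

    v≡ : arrs S orderᴬ (regs S iᴿ) ≡ vertexNumber v
    v≡ rewrite order-array | i-reg = arrayOf-tabulate (vertexNumber ∘ vertexAt σ) i

    x = proj₁ (first v)

    -- The cell and the search both give the leftmost earlier neighbour, which is unique, so the
    -- program loads the root.
    r≡ : fromMaybe i x ≡ r
    r≡ = cong (fromMaybe i) (Leftmost-unique (proj₂ (proj₂ (first v))) (leftNbr-leftmost G σ i))

    loadRoot≡ : ⟨ loadRoot (reg vᴿ) , S₀ ⟩⇓ running S₁ within 7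
    loadRoot≡ = subst (λ j → ⟨ loadRoot (reg vᴿ) , S₀ ⟩⇓ running (setReg rootᴿ (vertexNumber j) S₀) within 7) r≡
      (loadRoot-within x refl (proj₁ (proj₂ (first v))) i-reg)

    advance : ∀ {S} → m ≤ suc (toℕ r) → Registers (suc (toℕ i)) (suc (toℕ r)) S →
      FirstArray (λ w j → EarlierNbr G σ (toℕ i) w j ⊎ (j ≡ i × w ∈ nbrs v)) S →
      OrderInvariant (suc (toℕ i)) (suc (toℕ r)) S
    advance m≤r registers first = record
      { registers = registers
      ; first     = λ w → let x , first≡ , leftmost = first w in x , first≡ , Leftmost-resp extend restrict leftmost
      ; monotone  = λ j<k k≤i → mono j<k (ℕ.m≤n⇒m<n∨m≡n (ℕ.s≤s⁻¹ k≤i))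
      ; max-upper = λ j≤i → upper (ℕ.m≤n⇒m<n∨m≡n (ℕ.s≤s⁻¹ j≤i))
      ; max-value = inj₂ (i , ℕ.≤-refl , refl)
      }
      where
      extend : ∀ {w j} → EarlierNbr G σ (toℕ i) w j ⊎ (j ≡ i × w ∈ nbrs v) → EarlierNbr G σ (suc (toℕ i)) w j
      extend (inj₁ (j<i , adj)) = ℕ.m<n⇒m<1+n j<i , adj
      extend (inj₂ (refl , w∈)) = ℕ.≤-refl , symm G (Equivalence.to (complete _ _) w∈)
      restrict : ∀ {w j} → EarlierNbr G σ (suc (toℕ i)) w j → EarlierNbr G σ (toℕ i) w j ⊎ (j ≡ i × w ∈ nbrs v)
      restrict (j≤i , adj) with ℕ.m≤n⇒m<n∨m≡n (ℕ.s≤s⁻¹ j≤i)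
      ... | inj₁ j<i = inj₁ (j<i , adj)
      ... | inj₂ j≡i with refl ← Fin.toℕ-injective j≡i = inj₂ (refl , Equivalence.from (complete _ _) (symm G adj))
      mono : ∀ {j k} → j Fin.< k → k Fin.< i ⊎ toℕ k ≡ toℕ i → root G σ j Fin.≤ root G σ k
      mono j<k (inj₁ k<i) = monotone j<k k<i
      mono j<i (inj₂ k≡i) with refl ← Fin.toℕ-injective k≡i = ℕ.s≤s⁻¹ (ℕ.≤-trans (max-upper j<i) m≤r)
      upper : ∀ {j} → j Fin.< i ⊎ toℕ j ≡ toℕ i → suc (toℕ (root G σ j)) ≤ suc (toℕ r)
      upper (inj₁ j<i) = ℕ.≤-trans (max-upper j<i) m≤r
      upper (inj₂ j≡i) with refl ← Fin.toℕ-injective j≡i = ℕ.≤-refl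

    step : m ≤ suc (toℕ r) ⊎ suc (toℕ r) < m → OrderFrom (30 + (length (nbrsAt L σ i) * 21 + b)) S
    step (inj₂ r<m) = _
      , weaken (ℕ.m≤m+n 18 _) (while-returned-within test
          (seq-within (setReg-within v≡) (seq-within loadRoot≡
          (seq-returned-within (if-true-within (>ᵉ-true max-reg refl (ℤ.+<+ r<m)) (exactly ⇓return))))))
      , failed (λ mono → violated mono max-value)
      where
      violated : RootsMonotone G σ → ¬ (m ≡ 0 ⊎ ∃ λ j → toℕ j < toℕ i × m ≡ suc (toℕ (root G σ j)))
      violated _    (inj₁ refl) = ℕ.n≮0 r<m
      violated mono (inj₂ (j , j<i , refl)) = ℕ.<⇒≱ r<m (s≤s (mono j<i))
    step (inj₁ m≤r)
      with pre , post , split , start , end ← concat-at nbrs 1 v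
      with S′ , scanned , registers′ , first′ ← scan-loop i (nbrs v) {Q = EarlierNbr G σ (toℕ i)} {pre = pre}
             {S = setReg kᴿ (+ suc (length pre)) (setReg maxᴿ (vertexNumber r) S₁)}
             (λ (j<i , _) → ℕ.<⇒≤ j<i)
             (record { size-reg = size-reg ; i-reg = i-reg ; max-reg = refl
                     ; order-array = order-array ; offset-array = offset-array ; target-array = target-array })
             first split refl (trans (cong (λ α → α (ℤ.suc (vertexNumber v))) offset-array) end)
      with o , run , verdict ← continue {suc (toℕ r)} {setReg iᴿ (+ suc (suc (toℕ i))) S′}
             (advance m≤r (next-position registers′) first′)
      = o
      , weaken (ℕ.≤-reflexive (solve 2 (λ l b →
                 con 4 :+ (con 3 :+ (con 7 :+ (con 5 :+ (con 3 :+ (l :+ con 5 :+ con 3)))) :+ b)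
                 := con 30 :+ (l :+ b)) refl (length (nbrs v) * 21) b))
          (while-true-within test
            (seq-within (setReg-within v≡) (seq-within loadRoot≡
            (seq-within (if-false-within (>ᵉ-false max-reg refl (ℤ.+≤+ m≤r)) (setReg-within refl))
            (seq-within (setReg-within (trans (cong (λ α → α (vertexNumber v)) offset-array) start))
            (seq-within scanned (setReg-within (cong ℤ.suc (Registers.i-reg registers′)))))))) run)
      , verdict
      where
      open +-*-Solver

  -- With `d` positions left, the bound charges 30 to each, 21 to each of their list entries and 4
  -- to the last test; the inner loops are thus paid for jointly.
  order-loop : ∀ d p {m S} → p + d ≡ n → OrderInvariant p m S → OrderFrom (d * 30 + (work L σ p * 21 + 4)) S
  order-loop zero p p≡n inv =
    _ , weaken (ℕ.m≤n+m 4 _) (while-false-within (>ᵉ-false (cong ℤ.suc size-reg) i-reg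
          (ℤ.+≤+ (ℕ.≤-reflexive (cong suc (trans (sym p≡n) (ℕ.+-identityʳ p)))))))
    , passed λ {_} {j} i<j → monotone i<j (subst (toℕ j <_) (trans (sym p≡n) (ℕ.+-identityʳ p)) (Fin.toℕ<n j))
    where open OrderInvariant inv
  order-loop (suc d) p p+d≡n inv
    with continue ← (λ {m} {S} → order-loop d (suc p) {m} {S} (trans (sym (ℕ.+-suc p d)) p+d≡n))
    with i , refl ← position (subst (p <_) p+d≡n (ℕ.m<m+n p (s≤s z≤n)))
    with o , run , verdict ← order-step i inv continue
    = o , weaken (ℕ.≤-reflexive cost≡) run , verdict
    where
    open +-*-Solver
    cost≡ : 30 + (length (nbrsAt L σ i) * 21 + (d * 30 + (work L σ (suc p) * 21 + 4)))
            ≡ suc d * 30 + (work L σ p * 21 + 4)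
    cost≡ rewrite work-step L σ i = solve 3 (λ l d w →
      con 30 :+ (l :* con 21 :+ (d :* con 30 :+ (w :* con 21 :+ con 4))) :=
      (con 1 :+ d) :* con 30 :+ ((l :+ w) :* con 21 :+ con 4)) refl (length (nbrsAt L σ i)) d (work L σ (suc (toℕ i)))

bfsOrderingCheck-correct : ∀ {n} (G : Graph n) (L : AdjacencyLists G) (σ : Ordering n) →
  ∃₂ λ answer t →
    (⟨ bfsOrderingCheck , graphInput L σ ⟩⇓ returned answer cost t) ×
    (answer ≡ YES ⇔ IsBFSOrdering G σ) ×
    (1 ≤ n → t ≤ 42 * (n + edgeCount G))
bfsOrderingCheck-correct {n} G L σ =
  let answer , run , answer⇔ = answering (order-loop L σ n 0 refl (record
        { registers = record { size-reg = refl ; i-reg = refl ; max-reg = refl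
                             ; order-array = refl ; offset-array = refl ; target-array = refl }
        ; first     = λ w → nothing , refl , none λ ()
        ; monotone  = λ _ ()
        ; max-upper = λ ()
        ; max-value = inj₁ refl
        }))
      t , run′ , t≤ = seq-within (setReg-within refl) run
      BFS⇔ = BFS⇔RootsMonotone G σ
  in answer , t , run′ ,
     mk⇔ (Equivalence.from BFS⇔ ∘ Equivalence.to answer⇔) (Equivalence.from answer⇔ ∘ Equivalence.to BFS⇔) ,
     -- The constant 7 is raised to 12n so that `n` gets the coefficient 30 + 12 = 42, equal to the
     -- 21 · 2 of the edges.
     λ 1≤n → ℕ.≤-trans t≤ (begin
       2 + (n * 30 + (w * 21 + 4) + 1) ≡⟨ solve 2 (λ n w → con 2 :+ (n :* con 30 :+ (w :* con 21 :+ con 4) :+ con 1)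
                                            := con 30 :* n :+ con 7 :* con 1 :+ con 21 :* w) refl n w ⟩
       30 * n + 7 * 1 + 21 * w         ≤⟨ ℕ.+-mono-≤ (ℕ.+-monoʳ-≤ (30 * n) (ℕ.*-mono-≤ {7} {12} (ℕ.m≤m+n 7 5) 1≤n))
                                            (ℕ.*-monoʳ-≤ 21 (work≤2m L σ)) ⟩
       30 * n + 12 * n + 21 * (2 * m)  ≡⟨ solve 2 (λ n m → con 30 :* n :+ con 12 :* n :+ con 21 :* (con 2 :* m)
                                            := con 42 :* (n :+ m)) refl n m ⟩
       42 * (n + m)                    ∎)
  where
  open ℕ.≤-Reasoning
  open +-*-Solver
  w = work L σ 0
  m = edgeCount G

theorem12 : (∃ λ c → ∀ n (G : Graph n) (σ : Ordering n) → IsGENOrdering G σ →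
    ∃₂ λ answer t →
    (⟨ bfsCheck , leftmostLeftInput G σ ⟩⇓ returned answer cost t) ×
    (answer ≡ YES ⇔ IsBFSOrdering G σ) ×
    (1 ≤ n → t ≤ c * n))
    ×
    (∃₂ λ program c → ∀ n (G : Graph n) (L : AdjacencyLists G) (σ : Ordering n) →
    ∃₂ λ answer t →
    (⟨ program , graphInput L σ ⟩⇓ returned answer cost t) ×
    (answer ≡ YES ⇔ IsBFSOrdering G σ) ×
    (1 ≤ n → t ≤ c * (n + edgeCount G)))
theorem12 = (26 , λ n → bfsCheck-correct) , (bfsOrderingCheck , 42 , λ n → bfsOrderingCheck-correct)
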